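{- Let $C_5^-$ be the $3$-graph on vertex set $\{1,2,3,4,5\}$ with $3$-edges $123, 234, 345, 145$. For every positive integer $n$, $$\left\lfloor\frac n3\right\rfloor\le \mathrm{co^+ex}(n,C_5^-)\le \frac12 n .$$
   Context: A $3$-graph is a finite $3$-uniform hypergraph; an edge is written as the concatenation of its vertices. The minimum positive co-degree $\delta_2^+(H)$ of a non-empty $3$-graph $H$ is the maximum $k$ such that every pair of vertices contained in some edge of $H$ is contained in at least $k$ distinct edges of $H$; by convention it is $0$ if $H$ has no edges. A hypergraph is $F$-free if it has no (not necessarily induced) subhypergraph isomorphic to $F$. $\mathrm{co^+ex}(n,F)$ is the maximum of $\delta_2^+(H)$ over all $n$-vertex $F$-free $3$-graphs $H$. -}

module Defs where

open import Data.Bool.Properties using () renaming (_≟_ to _≟ᵇ_)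
open import Data.Fin using (Fin)
open import Data.Fin.Patterns using (0F; 1F; 2F; 3F; 4F)
open import Data.Fin.Subset using (Subset; _∪_; ⁅_⁆; ∣_∣)
  renaming (_∈_ to _∈ˢ_)
open import Data.Fin.Subset.Properties using (_∈?_)
open import Data.List using (List; []; _∷_; length; filter)
open import Data.List.Membership.Propositional using (_∈_)
open import Data.List.Relation.Unary.All using (All; []; _∷_)
open import Data.List.Relation.Unary.Any using (Any)
open import Data.List.Relation.Unary.Unique.Propositional using (Unique)
import Data.List.Relation.Unary.Unique.DecPropositional as DecUnique
open import Data.Nat using (ℕ; _≤_)
open import Data.Product using (Σ; ∃; _×_)
open import Data.Sum using (_⊎_)
open import Data.Vec.Properties using (≡-dec)
open import Function.Bundles using (_↣_; Injection)
open import Relation.Binary.PropositionalEquality using (_≡_; _≢_; refl)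
open import Relation.Nullary using (¬_)
open import Relation.Nullary.Decidable using (_×-dec_; from-yes)

record ThreeGraph (n : ℕ) : Set where
  field
    edges   : List (Subset n)
    unique  : Unique edges
    uniform : All (λ e → ∣ e ∣ ≡ 3) edges

open ThreeGraph public

triple : ∀ {n} → Fin n → Fin n → Fin n → Subset n
triple u v w = ⁅ u ⁆ ∪ ⁅ v ⁆ ∪ ⁅ w ⁆

-- An injective vertex map sending edges to edges; its image is a
-- (not necessarily induced) subhypergraph of H isomorphic to F.
-- Every edge of F has the form triple u v w by uniformity.
Copy : ∀ {m n} → ThreeGraph m → ThreeGraph n → Set
Copy {m} {n} F H = Σ (Fin m ↣ Fin n) λ φ → let open Injection φ in
  ∀ u v w → triple u v w ∈ edges F → triple (to u) (to v) (to w) ∈ edges H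

infix 4 _-free_

_-free_ : ∀ {m n} → ThreeGraph m → ThreeGraph n → Set
F -free H = ¬ Copy F H

codegree : ∀ {n} → ThreeGraph n → Fin n → Fin n → ℕ
codegree H u v = length (filter (λ e → (u ∈? e) ×-dec (v ∈? e)) (edges H))

IsMaximum : (ℕ → Set) → ℕ → Set
IsMaximum P k = P k × (∀ j → P j → j ≤ k)

PositiveCodegreesAtLeast : ∀ {n} → ThreeGraph n → ℕ → Set
PositiveCodegreesAtLeast H k = ∀ u v → u ≢ v →
  Any (λ e → u ∈ˢ e × v ∈ˢ e) (edges H) → k ≤ codegree H u v

-- d is δ₂⁺(H).
IsMinPositiveCodegree : ∀ {n} → ThreeGraph n → ℕ → Set
IsMinPositiveCodegree H d =
    (edges H ≡ [] × d ≡ 0)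
  ⊎ (edges H ≢ [] × IsMaximum (PositiveCodegreesAtLeast H) d)

-- k is co⁺ex(n, F).
IsCo⁺ex : ∀ {m} → ℕ → ThreeGraph m → ℕ → Set
IsCo⁺ex n F = IsMaximum λ d →
  ∃ λ (H : ThreeGraph n) → F -free H × IsMinPositiveCodegree H d

-- The vertices 1, …, 5 are 0F, …, 4F.
C₅⁻ : ThreeGraph 5
C₅⁻ = record
  { edges   = es
  ; unique  = from-yes (unique? es)
  ; uniform = refl ∷ refl ∷ refl ∷ refl ∷ []
  }
  where
  open DecUnique (≡-dec {n = 5} _≟ᵇ_) using (unique?)
  es : List (Subset 5)
  es = triple 0F 1F 2F ∷ triple 1F 2F 3F ∷ triple 2F 3F 4F ∷ triple 0F 3F 4F ∷ []

{-# OPTIONS --safe #-}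
module Submission where

-- Upper bound: if 2 δ₂⁺(H) > n, the links of two positive pairs uz and vz meet, even after one
-- vertex is discarded, because both avoid z. Starting from an edge, this yields K₄⁻ and then C₅⁻.
-- Lower bound: the rainbow triples of a balanced 3-colouring of the vertices.
-- The maximum exists constructively because edge lists without repetitions have bounded length,
-- so that attaining a given codegree is decidable.

open import Defs
open import Data.Nat using (ℕ; NonZero; _≤_; _/_)
open import Data.Integer using (+_)
open import Data.Product using (∃; _×_)
open import Data.Rational.Unnormalised using (½) renaming (_≤_ to _≤ℚ_; _*_ to _*ℚ_; _/_ to _/ℚ_)

import Data.Bool.Properties as Bool
open import Data.Fin using (Fin; toℕ; fromℕ<; _≟_)
open import Data.Fin.Patterns using (0F; 1F; 2F; 3F; 4F)
open import Data.Fin.Properties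
  using (any?; all?; injective⇒≤; toℕ-injective; toℕ-fromℕ<; fromℕ<-injective; toℕ<n)
open import Data.Fin.Subset using (Subset; inside; outside; _∪_; _⊆_; ⁅_⁆; ∣_∣)
  renaming (_∈_ to _∈ˢ_; _∉_ to _∉ˢ_; ⊥ to ∅)
open import Data.Fin.Subset.Properties
  using ( _∈?_; anySubset?; ∣⊥∣≡0; ∣⁅x⁆∣≡1; x∈⁅x⁆; x∈⁅y⁆⇒x≡y; x≢y⇒x∉⁅y⁆; x∉⁅y⁆⇒x≢y
        ; x∈p∪q⁺; x∈p∪q⁻; p⊆q⇒∣p∣≤∣q∣; p⊂q⇒∣p∣<∣q∣; q⊆p∪q; ⊆-antisym; ∪-comm; ∪-assoc)
import Data.Integer as ℤ
import Data.Integer.Properties as ℤ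
open import Data.List
  using (List; []; _∷_; _++_; length; filter; lookup; allFin; tabulate; map; cartesianProductWith)
open import Data.List.Membership.Propositional using (_∈_; _∉_; lose; find)
open import Data.List.Membership.Propositional.Properties
  using ( ∈-lookup; ∈-allFin; ∈-filter⁺; ∈-filter⁻; ∈-++⁻; ∈-map⁺; ∈-tabulate⁻
        ; ∈-cartesianProductWith⁺)
open import Data.List.Properties using (length-++; length-map; length-tabulate)
open import Data.List.Relation.Unary.All as All using (All; []; _∷_)
open import Data.List.Relation.Unary.AllPairs using ([]; _∷_)
open import Data.List.Relation.Unary.Any as Any using (Any; here; there; index)
open import Data.List.Relation.Unary.Any.Properties using (lookup-index)
open import Data.List.Relation.Unary.Unique.Propositional using (Unique)
open import Data.List.Relation.Unary.Unique.Propositional.Properties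
  using (++⁺; filter⁺; tabulate⁺; allFin⁺; cartesianProductWith⁺)
import Data.List.Membership.DecPropositional as DecMembership
import Data.List.Relation.Unary.Unique.DecPropositional as DecUnique
import Data.Nat as ℕ
open import Data.Nat using (zero; suc; _+_; _*_; _<_; z≤n; s≤s; _%_)
open import Data.Nat.DivMod
  using (_mod_; m/n*n≤m; m%n<n; [m+kn]%n≡m%n; m<n⇒m%n≡m)
open import Data.Nat.Properties
  using ( ≤-refl; ≤-reflexive; ≤-trans; ≤-antisym; <-≤-trans; <⇒≱; ≰⇒>; ≤∧≢⇒<
        ; +-mono-≤; +-monoˡ-≤; +-monoˡ-<; +-monoʳ-≤; +-suc; *-monoˡ-≤; +-cancelˡ-≡; *-cancelʳ-≡
        ; *-comm; +-identityʳ; m≤n⇒m≤1+n; m≤m+n; module ≤-Reasoning)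
open import Data.Product using (Σ; _,_; proj₁; proj₂; ∃₂)
open import Data.Rational.Unnormalised using (*≤*)
open import Data.Sum using (_⊎_; inj₁; inj₂; [_,_]′)
open import Data.Vec using ([]; _∷_)
open import Data.Vec.Properties using (≡-dec; ∷-injective)
open import Function using (_∘_; id; case_of_)
open import Function.Bundles using (mk↣; Injection)
open import Relation.Binary.PropositionalEquality
  using (_≡_; _≢_; refl; sym; trans; cong; cong₂; subst; subst₂; ≢-sym; module ≡-Reasoning)
open import Relation.Nullary using (¬_; Dec; yes; no; contradiction)
open import Relation.Nullary.Decidable
  using (_×-dec_; _→-dec_; _⊎-dec_; ¬?; map′; decidable-stable)
open import Relation.Unary using (Decidable)

private
  variable
    n : ℕ

-- Lists without repetitions

lookup-injective : ∀ {A : Set} {xs : List A} → Unique xs →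
  ∀ {i j} → lookup xs i ≡ lookup xs j → i ≡ j
lookup-injective (_ ∷ _)  {0F} {0F} _ = refl
lookup-injective (x≢ ∷ _) {0F} {Fin.suc j} eq = contradiction eq (All.lookup x≢ (∈-lookup j))
lookup-injective (x≢ ∷ _) {Fin.suc i} {0F} eq = contradiction (sym eq) (All.lookup x≢ (∈-lookup i))
lookup-injective (_ ∷ u)  {Fin.suc i} {Fin.suc j} eq = cong Fin.suc (lookup-injective u eq)

-- Sending a position in `xs` to the position of the same element in `ys` is injective, because `xs`
-- does not repeat.
unique-⊆⇒length≤ : ∀ {A : Set} {xs ys : List A} → Unique xs →
  (∀ {x} → x ∈ xs → x ∈ ys) → length xs ≤ length ys
unique-⊆⇒length≤ {xs = xs} {ys} u xs⊆ys = injective⇒≤ {f = position} λ {i} {j} eq →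
  lookup-injective u (trans (found i) (trans (cong (lookup ys) eq) (sym (found j))))
  where
  position : Fin (length xs) → Fin (length ys)
  position i = index (xs⊆ys (∈-lookup i))
  found : ∀ i → lookup xs i ≡ lookup ys (position i)
  found i = lookup-index (xs⊆ys (∈-lookup i))

unique⇒length≤n : {xs : List (Fin n)} → Unique xs → length xs ≤ n
unique⇒length≤n {n} u =
  ≤-trans (unique-⊆⇒length≤ u (λ {x} _ → ∈-allFin x)) (≤-reflexive (length-tabulate id))

-- Avoiding d leaves n − 1 values for more than n entries, so two values repeat; one may be b.
common-element : {xs ys : List (Fin n)} → Unique xs → Unique ys →
  ∀ d → d ∉ xs → d ∉ ys → n < length xs + length ys →
  ∀ b → ∃ λ z → z ∈ xs × z ∈ ys × z ≢ b
common-element {n} {xs} {ys} uxs uys d d∉xs d∉ys n<∣xs∣+∣ys∣ b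
  with any? (λ z → (z ∈ᶠ? xs) ×-dec (z ∈ᶠ? ys) ×-dec ¬? (z ≟ b))
  where open DecMembership (_≟_ {n}) renaming (_∈?_ to _∈ᶠ?_)
... | yes found = found
... | no none = contradiction (unique⇒length≤n uzs) (<⇒≱ (<-≤-trans n<∣xs∣+∣ys∣ ∣xs∣+∣ys∣≤∣zs∣))
  where
  ≢b? : Decidable (_≢ b)
  ≢b? z = ¬? (z ≟ b)
  xs′ = filter ≢b? xs
  d≢ : ∀ {z} → z ∈ xs′ ++ ys → d ≢ z
  d≢ z∈ refl with ∈-++⁻ xs′ z∈
  ... | inj₁ z∈xs′ = d∉xs (proj₁ (∈-filter⁻ ≢b? {xs = xs} z∈xs′))
  ... | inj₂ z∈ys  = d∉ys z∈ys
  uzs : Unique (d ∷ xs′ ++ ys)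
  uzs = All.tabulate d≢ ∷ ++⁺ (filter⁺ ≢b? uxs) uys λ (z∈xs′ , z∈ys) →
    let z∈xs , z≢b = ∈-filter⁻ ≢b? {xs = xs} z∈xs′ in none (_ , z∈xs , z∈ys , z≢b)
  xs⊆b∷xs′ : ∀ {z} → z ∈ xs → z ∈ b ∷ xs′
  xs⊆b∷xs′ {z} z∈xs with z ≟ b
  ... | yes refl = here refl
  ... | no z≢b   = there (∈-filter⁺ ≢b? z∈xs z≢b)
  -- Filtering out b costs at most one entry, and the extra entry d makes up for it.
  ∣xs∣+∣ys∣≤∣zs∣ : length xs + length ys ≤ length (d ∷ xs′ ++ ys)
  ∣xs∣+∣ys∣≤∣zs∣ = begin
    length xs + length ys          ≤⟨ +-monoˡ-≤ (length ys) (unique-⊆⇒length≤ uxs xs⊆b∷xs′) ⟩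
    suc (length xs′ + length ys)   ≡⟨ cong suc (length-++ xs′) ⟨
    suc (length (xs′ ++ ys))       ∎
    where open ≤-Reasoning

-- Subsets and triples

∣p∪q∣≤∣p∣+∣q∣ : (p q : Subset n) → ∣ p ∪ q ∣ ≤ ∣ p ∣ + ∣ q ∣
∣p∪q∣≤∣p∣+∣q∣ [] [] = z≤n
∣p∪q∣≤∣p∣+∣q∣ (outside ∷ p) (outside ∷ q) = ∣p∪q∣≤∣p∣+∣q∣ p q
∣p∪q∣≤∣p∣+∣q∣ (outside ∷ p) (inside ∷ q)
  rewrite +-suc ∣ p ∣ ∣ q ∣ = s≤s (∣p∪q∣≤∣p∣+∣q∣ p q)
∣p∪q∣≤∣p∣+∣q∣ (inside ∷ p) (outside ∷ q) = s≤s (∣p∪q∣≤∣p∣+∣q∣ p q)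
∣p∪q∣≤∣p∣+∣q∣ (inside ∷ p) (inside ∷ q)
  rewrite +-suc ∣ p ∣ ∣ q ∣ = s≤s (m≤n⇒m≤1+n (∣p∪q∣≤∣p∣+∣q∣ p q))

∣q∣<∣p∣⇒∃∈p∉q : {p q : Subset n} → ∣ q ∣ < ∣ p ∣ → ∃ λ x → x ∈ˢ p × x ∉ˢ q
∣q∣<∣p∣⇒∃∈p∉q {p = p} {q} ∣q∣<∣p∣ with any? (λ x → (x ∈? p) ×-dec ¬? (x ∈? q))
... | yes found = found
... | no none = contradiction
  (p⊆q⇒∣p∣≤∣q∣ λ {x} x∈p → decidable-stable (x ∈? q) λ x∉q → none (x , x∈p , x∉q))
  (<⇒≱ ∣q∣<∣p∣)

p⊆q∧∣q∣≤∣p∣⇒p≡q : {p q : Subset n} → p ⊆ q → ∣ q ∣ ≤ ∣ p ∣ → p ≡ q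
p⊆q∧∣q∣≤∣p∣⇒p≡q {p = p} p⊆q ∣q∣≤∣p∣ = ⊆-antisym p⊆q λ {x} x∈q →
  decidable-stable (x ∈? p) λ x∉p →
    <⇒≱ (p⊂q⇒∣p∣<∣q∣ (p⊆q , x , x∈q , x∉p)) ∣q∣≤∣p∣

x∈⁅u⁆∪⁅v⁆⁻ : ∀ {x} (u v : Fin n) → x ∈ˢ ⁅ u ⁆ ∪ ⁅ v ⁆ → x ≡ u ⊎ x ≡ v
x∈⁅u⁆∪⁅v⁆⁻ u v x∈ with x∈p∪q⁻ ⁅ u ⁆ ⁅ v ⁆ x∈
... | inj₁ x∈u = inj₁ (x∈⁅y⁆⇒x≡y u x∈u)
... | inj₂ x∈v = inj₂ (x∈⁅y⁆⇒x≡y v x∈v)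

∈-triple⁻ : ∀ {x} (u v w : Fin n) → x ∈ˢ triple u v w → x ≡ u ⊎ x ≡ v ⊎ x ≡ w
∈-triple⁻ u v w x∈ with x∈p∪q⁻ ⁅ u ⁆ (⁅ v ⁆ ∪ ⁅ w ⁆) x∈
... | inj₁ x∈u  = inj₁ (x∈⁅y⁆⇒x≡y u x∈u)
... | inj₂ x∈vw = inj₂ (x∈⁅u⁆∪⁅v⁆⁻ v w x∈vw)

module _ (u v w : Fin n) where

  ∈-triple₁ : u ∈ˢ triple u v w
  ∈-triple₁ = x∈p∪q⁺ (inj₁ (x∈⁅x⁆ u))

  ∈-triple₂ : v ∈ˢ triple u v w
  ∈-triple₂ = x∈p∪q⁺ (inj₂ (x∈p∪q⁺ (inj₁ (x∈⁅x⁆ v))))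

  ∈-triple₃ : w ∈ˢ triple u v w
  ∈-triple₃ = x∈p∪q⁺ (inj₂ (x∈p∪q⁺ {p = ⁅ v ⁆} (inj₂ (x∈⁅x⁆ w))))

  triple-⊆ : {e : Subset n} → u ∈ˢ e → v ∈ˢ e → w ∈ˢ e → triple u v w ⊆ e
  triple-⊆ u∈e v∈e w∈e x∈ with ∈-triple⁻ u v w x∈
  ... | inj₁ refl        = u∈e
  ... | inj₂ (inj₁ refl) = v∈e
  ... | inj₂ (inj₂ refl) = w∈e

  triple-rotate : triple u v w ≡ triple w u v
  triple-rotate = trans (sym (∪-assoc ⁅ u ⁆ ⁅ v ⁆ ⁅ w ⁆)) (∪-comm (⁅ u ⁆ ∪ ⁅ v ⁆) ⁅ w ⁆)

  ∣triple∣≡3 : u ≢ v → u ≢ w → v ≢ w → ∣ triple u v w ∣ ≡ 3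
  ∣triple∣≡3 u≢v u≢w v≢w = ≤-antisym upper lower
    where
    open ≤-Reasoning
    upper : ∣ triple u v w ∣ ≤ 3
    upper = begin
      ∣ triple u v w ∣                      ≤⟨ ∣p∪q∣≤∣p∣+∣q∣ ⁅ u ⁆ _ ⟩
      ∣ ⁅ u ⁆ ∣ + ∣ ⁅ v ⁆ ∪ ⁅ w ⁆ ∣          ≤⟨ +-monoʳ-≤ ∣ ⁅ u ⁆ ∣ (∣p∪q∣≤∣p∣+∣q∣ ⁅ v ⁆ _) ⟩
      ∣ ⁅ u ⁆ ∣ + (∣ ⁅ v ⁆ ∣ + ∣ ⁅ w ⁆ ∣)     ≡⟨ cong₂ _+_ (∣⁅x⁆∣≡1 u)
                                                 (cong₂ _+_ (∣⁅x⁆∣≡1 v) (∣⁅x⁆∣≡1 w)) ⟩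
      3                                     ∎
    lower : 3 ≤ ∣ triple u v w ∣
    lower = begin
      3                          ≡⟨ cong (suc ∘ suc) (∣⁅x⁆∣≡1 w) ⟨
      suc (suc ∣ ⁅ w ⁆ ∣)         ≤⟨ s≤s (p⊂q⇒∣p∣<∣q∣
                                      (q⊆p∪q ⁅ v ⁆ ⁅ w ⁆ , v ,
                                        x∈p∪q⁺ (inj₁ (x∈⁅x⁆ v)) , x≢y⇒x∉⁅y⁆ v≢w)) ⟩
      suc ∣ ⁅ v ⁆ ∪ ⁅ w ⁆ ∣       ≤⟨ p⊂q⇒∣p∣<∣q∣
                                      (q⊆p∪q ⁅ u ⁆ _ , u ,
                                        ∈-triple₁ , [ u≢v , u≢w ]′ ∘ x∈⁅u⁆∪⁅v⁆⁻ v w) ⟩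
      ∣ triple u v w ∣           ∎

triple-swapʳ : (u v w : Fin n) → triple u v w ≡ triple u w v
triple-swapʳ u v w = cong (⁅ u ⁆ ∪_) (∪-comm ⁅ v ⁆ ⁅ w ⁆)

triple-swapˡ : (u v w : Fin n) → triple u v w ≡ triple v u w
triple-swapˡ u v w = trans (triple-rotate u v w) (trans (triple-rotate w u v) (triple-swapʳ v w u))

triple-image : ∀ {m} (f : Fin m → Fin n) {u v w u′ v′ w′} →
  triple u v w ⊆ triple u′ v′ w′ →
  triple (f u) (f v) (f w) ⊆ triple (f u′) (f v′) (f w′)
triple-image f {u} {v} {w} {u′} {v′} {w′} uvw⊆ =
  triple-⊆ _ _ _ (image (∈-triple₁ u v w)) (image (∈-triple₂ u v w)) (image (∈-triple₃ u v w))
  where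
  image : ∀ {x} → x ∈ˢ triple u v w → f x ∈ˢ triple (f u′) (f v′) (f w′)
  image x∈ with ∈-triple⁻ u′ v′ w′ (uvw⊆ x∈)
  ... | inj₁ refl        = ∈-triple₁ _ _ _
  ... | inj₂ (inj₁ refl) = ∈-triple₂ _ _ _
  ... | inj₂ (inj₂ refl) = ∈-triple₃ (f u′) _ _

-- `Copy` tests every way of writing an edge as `triple u v w`, with the vertices in any order. As
-- the image triple depends only on the set, one presentation of each edge is enough.
triple-map-cong : ∀ {m} (f : Fin m → Fin n) {u v w u′ v′ w′} →
  triple u v w ≡ triple u′ v′ w′ →
  triple (f u) (f v) (f w) ≡ triple (f u′) (f v′) (f w′)
triple-map-cong f {u} {v} {w} {u′} {v′} {w′} eq = ⊆-antisym
  (triple-image f {u} {v} {w} {u′} {v′} {w′} (subst (_ ∈ˢ_) eq))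
  (triple-image f {u′} {v′} {w′} {u} {v} {w} (subst (_ ∈ˢ_) (sym eq)))

-- The pair has at most two elements, so e has a vertex w outside it. Then `triple u v w` lies in e
-- and has the same size, which forces equality.
third-vertex : {e : Subset n} → ∣ e ∣ ≡ 3 → ∀ {u v} → u ≢ v → u ∈ˢ e → v ∈ˢ e →
  ∃ λ w → w ≢ u × w ≢ v × triple u v w ≡ e
third-vertex {n} {e} ∣e∣≡3 {u} {v} u≢v u∈e v∈e
  with w , w∈e , w∉uv ← ∣q∣<∣p∣⇒∃∈p∉q {q = ⁅ u ⁆ ∪ ⁅ v ⁆}
         (subst (_ <_) (sym ∣e∣≡3) (s≤s (≤-trans (∣p∪q∣≤∣p∣+∣q∣ ⁅ u ⁆ ⁅ v ⁆)
           (≤-reflexive (cong₂ _+_ (∣⁅x⁆∣≡1 u) (∣⁅x⁆∣≡1 v))))))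
  with w≢u ← x∉⁅y⁆⇒x≢y (w∉uv ∘ x∈p∪q⁺ ∘ inj₁)
  with w≢v ← x∉⁅y⁆⇒x≢y (w∉uv ∘ x∈p∪q⁺ {p = ⁅ u ⁆} ∘ inj₂)
  = w , w≢u , w≢v ,
    p⊆q∧∣q∣≤∣p∣⇒p≡q (triple-⊆ u v w u∈e v∈e w∈e)
      (≤-reflexive (trans ∣e∣≡3 (sym (∣triple∣≡3 u v w u≢v (≢-sym w≢u) (≢-sym w≢v)))))
∣e∣≡3⇒triple : {e : Subset n} → ∣ e ∣ ≡ 3 →
  ∃ λ u → ∃₂ λ v w → u ≢ v × w ≢ u × w ≢ v × triple u v w ≡ e
∣e∣≡3⇒triple {n} ∣e∣≡3
  with u , u∈e , _   ← ∣q∣<∣p∣⇒∃∈p∉q {q = ∅}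
         (subst₂ _<_ (sym (∣⊥∣≡0 n)) (sym ∣e∣≡3) (s≤s z≤n))
  with v , v∈e , v∉u ← ∣q∣<∣p∣⇒∃∈p∉q
         (subst₂ _<_ (sym (∣⁅x⁆∣≡1 u)) (sym ∣e∣≡3) (s≤s (s≤s z≤n)))
  with u≢v ← ≢-sym (x∉⁅y⁆⇒x≢y v∉u)
  = let w , w≢u , w≢v , eq = third-vertex ∣e∣≡3 u≢v u∈e v∈e
    in u , v , w , u≢v , w≢u , w≢v , eq

_≟ˢ_ : (p q : Subset n) → Dec (p ≡ q)
_≟ˢ_ = ≡-dec Bool._≟_

_∈ᵉ?_ : (e : Subset n) (es : List (Subset n)) → Dec (e ∈ es)
_∈ᵉ?_ = DecMembership._∈?_ _≟ˢ_

pair? : (u v : Fin n) → Decidable λ e → u ∈ˢ e × v ∈ˢ e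
pair? u v e = (u ∈? e) ×-dec (v ∈? e)

-- Copies of C₅⁻

-- A copy as finite data: five vertices and four memberships. Unlike an injection with a universally
-- quantified condition, this is decided by running through all choices of vertices.
record IsC₅⁻ (es : List (Subset n)) (a b c d e : Fin n) : Set where
  constructor isC₅⁻
  field
    distinct : Unique (a ∷ b ∷ c ∷ d ∷ e ∷ [])
    abc∈ : triple a b c ∈ es
    bcd∈ : triple b c d ∈ es
    cde∈ : triple c d e ∈ es
    ade∈ : triple a d e ∈ es

ContainsC₅⁻ : List (Subset n) → Set
ContainsC₅⁻ es = ∃ λ a → ∃ λ b → ∃ λ c → ∃ λ d → ∃ λ e → IsC₅⁻ es a b c d e

isC₅⁻? : (es : List (Subset n)) → ∀ a b c d e → Dec (IsC₅⁻ es a b c d e)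
isC₅⁻? es a b c d e = map′
  (λ (u , p , q , r , s) → isC₅⁻ u p q r s)
  (λ (isC₅⁻ u p q r s) → u , p , q , r , s)
  (DecUnique.unique? _≟_ _ ×-dec (_ ∈ᵉ? es) ×-dec (_ ∈ᵉ? es) ×-dec (_ ∈ᵉ? es) ×-dec (_ ∈ᵉ? es))

containsC₅⁻? : (es : List (Subset n)) → Dec (ContainsC₅⁻ es)
containsC₅⁻? es =
  any? λ a → any? λ b → any? λ c → any? λ d → any? λ e → isC₅⁻? es a b c d e

module _ (H : ThreeGraph n) where

  contains⇒copy : ContainsC₅⁻ (edges H) → Copy C₅⁻ H
  contains⇒copy (a , b , c , d , e , isC₅⁻ u abc∈ bcd∈ cde∈ ade∈) =
    mk↣ {to = φ} (lookup-injective u) , preserves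
    where
    φ : Fin 5 → Fin n
    φ = lookup (a ∷ b ∷ c ∷ d ∷ e ∷ [])
    edge : ∀ {u v w u′ v′ w′} → triple u v w ≡ triple u′ v′ w′ →
      triple (φ u′) (φ v′) (φ w′) ∈ edges H → triple (φ u) (φ v) (φ w) ∈ edges H
    edge {u} {v} {w} {u′} {v′} {w′} eq =
      subst (_∈ edges H) (sym (triple-map-cong φ {u} {v} {w} {u′} {v′} {w′} eq))
    preserves : ∀ u v w → triple u v w ∈ edges C₅⁻ → triple (φ u) (φ v) (φ w) ∈ edges H
    preserves u v w (here eq)                         = edge {u} {v} {w} {0F} {1F} {2F} eq abc∈
    preserves u v w (there (here eq))                 = edge {u} {v} {w} {1F} {2F} {3F} eq bcd∈
    preserves u v w (there (there (here eq)))         = edge {u} {v} {w} {2F} {3F} {4F} eq cde∈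
    preserves u v w (there (there (there (here eq)))) = edge {u} {v} {w} {0F} {3F} {4F} eq ade∈

  copy⇒contains : Copy C₅⁻ H → ContainsC₅⁻ (edges H)
  copy⇒contains (φ , preserves) = to 0F , to 1F , to 2F , to 3F , to 4F , isC₅⁻
    (tabulate⁺ injective)
    (preserves 0F 1F 2F (here refl))
    (preserves 1F 2F 3F (there (here refl)))
    (preserves 2F 3F 4F (there (there (here refl))))
    (preserves 0F 3F 4F (there (there (there (here refl)))))
    where open Injection φ

  C₅⁻-free? : Dec (C₅⁻ -free H)
  C₅⁻-free? = map′ (_∘ copy⇒contains) (_∘ contains⇒copy) (¬? (containsC₅⁻? (edges H)))

-- The upper bound

module _ {H : ThreeGraph n} {k : ℕ} (δ≥k : PositiveCodegreesAtLeast H k) where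

  -- Counting edges through u and v becomes counting third vertices: each such edge is
  -- `triple u v t` for some listed t, so the list is at least as long as the codegree, which is at
  -- least k since uvw makes the pair positive.
  link-list : ∀ {u v w} → u ≢ v → triple u v w ∈ edges H →
    ∃ λ ts → Unique ts × k ≤ length ts ×
      (∀ {t} → t ∈ ts → t ≢ u × t ≢ v × triple u v t ∈ edges H)
  link-list {u} {v} {w} u≢v uvw∈ =
    ts , filter⁺ link? (allFin⁺ n) , k≤∣ts∣ , λ t∈ → proj₂ (∈-filter⁻ link? {xs = allFin n} t∈)
    where
    open ≤-Reasoning
    link? : Decidable λ t → t ≢ u × t ≢ v × triple u v t ∈ edges H
    link? t = ¬? (t ≟ u) ×-dec ¬? (t ≟ v) ×-dec (triple u v t ∈ᵉ? edges H)
    ts = filter link? (allFin n)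
    edge-in-image : ∀ {e} → e ∈ filter (pair? u v) (edges H) → e ∈ map (triple u v) ts
    edge-in-image {e} e∈
      with e∈H , u∈e , v∈e ← ∈-filter⁻ (pair? u v) {xs = edges H} e∈
      with t , t≢u , t≢v , refl ← third-vertex (All.lookup (uniform H) e∈H) u≢v u∈e v∈e
      = ∈-map⁺ (triple u v) (∈-filter⁺ link? (∈-allFin t) (t≢u , t≢v , e∈H))
    k≤∣ts∣ : k ≤ length ts
    k≤∣ts∣ = begin
      k                            ≤⟨ δ≥k u v u≢v (lose uvw∈ (∈-triple₁ u v w , ∈-triple₂ u v w)) ⟩
      codegree H u v               ≤⟨ unique-⊆⇒length≤ (filter⁺ (pair? u v) (unique H)) edge-in-image ⟩
      length (map (triple u v) ts) ≡⟨ length-map (triple u v) ts ⟩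
      length ts                    ∎

  module _ (n<k+k : n < k + k) where

    -- The two links avoid the vertex shared by the pairs, whence the freedom to avoid b as well.
    common-neighbour : ∀ {u v x y z} → u ≢ z → v ≢ z →
      triple u z x ∈ edges H → triple v z y ∈ edges H → ∀ b →
      ∃ λ t → t ≢ u × t ≢ v × t ≢ z × t ≢ b × triple u z t ∈ edges H × triple v z t ∈ edges H
    common-neighbour {z = z} u≢z v≢z uzx∈ vzy∈ b =
      let ts , uts , k≤∣ts∣ , ts-link = link-list u≢z uzx∈
          ss , uss , k≤∣ss∣ , ss-link = link-list v≢z vzy∈
          t , t∈ts , t∈ss , t≢b = common-element uts uss z
            (λ z∈ → proj₁ (proj₂ (ts-link z∈)) refl)
            (λ z∈ → proj₁ (proj₂ (ss-link z∈)) refl)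
            (<-≤-trans n<k+k (+-mono-≤ k≤∣ts∣ k≤∣ss∣)) b
          t≢u , t≢z , uzt∈ = ts-link t∈ts
          t≢v , _   , vzt∈ = ss-link t∈ss
      in t , t≢u , t≢v , t≢z , t≢b , uzt∈ , vzt∈

    -- A common neighbour x of uv and uw yields the edges uvw, uvx and uwx; a common neighbour
    -- y ≠ u of vx and wx then closes up the copy wuv, uvx, vxy, wxy.
    triple⇒contains : ∀ {u v w} → u ≢ v → w ≢ u → w ≢ v →
      triple u v w ∈ edges H → ContainsC₅⁻ (edges H)
    triple⇒contains {u} {v} {w} u≢v w≢u w≢v uvw∈ =
      let wuv∈ = subst (_∈ edges H) (triple-rotate u v w) uvw∈
          -- The final argument u is a default here: `x≢u` already comes from avoiding the shared
          -- vertex. In the next call, where x is shared, it secures `y≢u`.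
          x , x≢v , x≢w , x≢u , _ , vux∈ , wux∈ =
            common-neighbour (≢-sym u≢v) w≢u (subst (_∈ edges H) (triple-swapˡ u v w) uvw∈) wuv∈ u
          y , y≢v , y≢w , y≢x , y≢u , vxy∈ , wxy∈ =
            common-neighbour (≢-sym x≢v) (≢-sym x≢w)
              (subst (_∈ edges H) (triple-swapʳ v u x) vux∈)
              (subst (_∈ edges H) (triple-swapʳ w u x) wux∈) u
      in w , u , v , x , y , isC₅⁻
        ( (w≢u ∷ w≢v ∷ ≢-sym x≢w ∷ ≢-sym y≢w ∷ [])
        ∷ (u≢v ∷ ≢-sym x≢u ∷ ≢-sym y≢u ∷ [])
        ∷ (≢-sym x≢v ∷ ≢-sym y≢v ∷ [])
        ∷ (≢-sym y≢x ∷ [])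
        ∷ [] ∷ [])
        wuv∈
        (subst (_∈ edges H) (triple-swapˡ v u x) vux∈)
        vxy∈
        wxy∈

    edge⇒contains : ∀ {e} → e ∈ edges H → ContainsC₅⁻ (edges H)
    edge⇒contains e∈ =
      let _ , _ , _ , u≢v , w≢u , w≢v , uvw≡e = ∣e∣≡3⇒triple (All.lookup (uniform H) e∈)
      in triple⇒contains u≢v w≢u w≢v (subst (_∈ edges H) (sym uvw≡e) e∈)

-- The lower bound

third-colour : ∀ (i j : Fin 3) → ∃ λ k → k ≢ i × k ≢ j
third-colour 0F 0F = 1F , (λ ()) , (λ ())
third-colour 0F 1F = 2F , (λ ()) , (λ ())
third-colour 0F 2F = 1F , (λ ()) , (λ ())
third-colour 1F 0F = 2F , (λ ()) , (λ ())
third-colour 1F 1F = 0F , (λ ()) , (λ ())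
third-colour 1F 2F = 0F , (λ ()) , (λ ())
third-colour 2F 0F = 1F , (λ ()) , (λ ())
third-colour 2F 1F = 0F , (λ ()) , (λ ())
third-colour 2F 2F = 0F , (λ ()) , (λ ())

-- The inequalities are ordered as the edges abc, bcd and ade of a copy supply them.
no-four-colours : ∀ {i j k l : Fin 3} →
  i ≢ j → i ≢ k → j ≢ k → j ≢ l → k ≢ l → ¬ i ≢ l
no-four-colours {i} {j} {k} {l} i≢j i≢k j≢k j≢l k≢l i≢l =
  <⇒≱ ≤-refl (unique⇒length≤n {xs = i ∷ j ∷ k ∷ l ∷ []}
    ((i≢j ∷ i≢k ∷ i≢l ∷ []) ∷ (j≢k ∷ j≢l ∷ []) ∷ (k≢l ∷ []) ∷ [] ∷ []))

-- This enumeration has two uses: filtering it gives the edges of the tripartite graph, and its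
-- length bounds every edge list in the search for the maximum.
allSubsets : ∀ n → List (Subset n)
allSubsets zero    = [] ∷ []
allSubsets (suc n) = cartesianProductWith _∷_ (inside ∷ outside ∷ []) (allSubsets n)

∈-allSubsets : (p : Subset n) → p ∈ allSubsets n
∈-allSubsets []            = here refl
∈-allSubsets (inside ∷ p)  = ∈-cartesianProductWith⁺ _∷_ {xs = inside ∷ outside ∷ []}
  (here refl) (∈-allSubsets p)
∈-allSubsets (outside ∷ p) = ∈-cartesianProductWith⁺ _∷_ {xs = inside ∷ outside ∷ []}
  (there (here refl)) (∈-allSubsets p)

allSubsets-unique : ∀ n → Unique (allSubsets n)
allSubsets-unique zero    = [] ∷ []
allSubsets-unique (suc n) =
  cartesianProductWith⁺ _∷_ ∷-injective (((λ ()) ∷ []) ∷ [] ∷ []) (allSubsets-unique n)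

module _ (colour : Fin n → Fin 3) where

  Rainbow : Subset n → Set
  Rainbow e = ∣ e ∣ ≡ 3 ×
    (∀ u v → u ∈ˢ e → v ∈ˢ e → u ≢ v → colour u ≢ colour v)

  rainbow? : Decidable Rainbow
  rainbow? e = (∣ e ∣ ℕ.≟ 3) ×-dec
    all? λ u → all? λ v →
      (u ∈? e) →-dec (v ∈? e) →-dec ¬? (u ≟ v) →-dec ¬? (colour u ≟ colour v)

  rainbowEdges : List (Subset n)
  rainbowEdges = filter rainbow? (allSubsets n)

  edge⇒rainbow : ∀ {e} → e ∈ rainbowEdges → Rainbow e
  edge⇒rainbow = proj₂ ∘ ∈-filter⁻ rainbow? {xs = allSubsets n}

  rainbow⇒edge : ∀ {e} → Rainbow e → e ∈ rainbowEdges
  rainbow⇒edge {e} = ∈-filter⁺ rainbow? (∈-allSubsets e)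

  -- The complete tripartite 3-graph whose parts are the colour classes.
  tripartite : ThreeGraph n
  tripartite = record
    { edges   = rainbowEdges
    ; unique  = filter⁺ rainbow? (allSubsets-unique n)
    ; uniform = All.tabulate (proj₁ ∘ edge⇒rainbow)
    }

  rainbow-triple : ∀ {u v w} →
    colour u ≢ colour v → colour u ≢ colour w → colour v ≢ colour w → Rainbow (triple u v w)
  rainbow-triple {u} {v} {w} u≢v u≢w v≢w =
    ∣triple∣≡3 u v w (u≢v ∘ cong colour) (u≢w ∘ cong colour) (v≢w ∘ cong colour) ,
    λ x y x∈ y∈ → separated (∈-triple⁻ u v w x∈) (∈-triple⁻ u v w y∈)
    where
    separated : ∀ {x y} → x ≡ u ⊎ x ≡ v ⊎ x ≡ w → y ≡ u ⊎ y ≡ v ⊎ y ≡ w →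
      x ≢ y → colour x ≢ colour y
    separated (inj₁ refl)        (inj₁ refl)        x≢y = contradiction refl x≢y
    separated (inj₁ refl)        (inj₂ (inj₁ refl)) _   = u≢v
    separated (inj₁ refl)        (inj₂ (inj₂ refl)) _   = u≢w
    separated (inj₂ (inj₁ refl)) (inj₁ refl)        _   = ≢-sym u≢v
    separated (inj₂ (inj₁ refl)) (inj₂ (inj₁ refl)) x≢y = contradiction refl x≢y
    separated (inj₂ (inj₁ refl)) (inj₂ (inj₂ refl)) _   = v≢w
    separated (inj₂ (inj₂ refl)) (inj₁ refl)        _   = ≢-sym u≢w
    separated (inj₂ (inj₂ refl)) (inj₂ (inj₁ refl)) _   = ≢-sym v≢w
    separated (inj₂ (inj₂ refl)) (inj₂ (inj₂ refl)) x≢y = contradiction refl x≢y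

  -- The edges abc and bcd force a and d to have the same colour, but ade is an edge.
  tripartite-free : C₅⁻ -free tripartite
  tripartite-free copy
    with a , b , c , d , e , isC₅⁻ u abc∈ bcd∈ _ ade∈ ← copy⇒contains tripartite copy
    with (a≢b ∷ a≢c ∷ a≢d ∷ _) ∷ (b≢c ∷ b≢d ∷ _) ∷ (c≢d ∷ _) ∷ _ ← u
    with _ , abc ← edge⇒rainbow abc∈ | _ , bcd ← edge⇒rainbow bcd∈ | _ , ade ← edge⇒rainbow ade∈
    = no-four-colours
        (abc a b (∈-triple₁ a b c) (∈-triple₂ a b c) a≢b)
        (abc a c (∈-triple₁ a b c) (∈-triple₃ a b c) a≢c)
        (abc b c (∈-triple₂ a b c) (∈-triple₃ a b c) b≢c)
        (bcd b d (∈-triple₁ b c d) (∈-triple₃ b c d) b≢d)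
        (bcd c d (∈-triple₂ b c d) (∈-triple₃ b c d) c≢d)
        (ade a d (∈-triple₁ a d e) (∈-triple₂ a d e) a≢d)

  module _ {k : ℕ} (class : Fin 3 → Fin k → Fin n)
    (class-injective : ∀ c {i j} → class c i ≡ class c j → i ≡ j)
    (colour-class : ∀ c i → colour (class c i) ≡ c) where

    -- A positive pair lies in a rainbow edge, so its two colours differ. Each of the k vertices
    -- that `class` lists in the remaining colour completes the pair to an edge, and different
    -- vertices give different edges.
    tripartite-codegrees : PositiveCodegreesAtLeast tripartite k
    tripartite-codegrees u v u≢v positive
      with e , e∈ , u∈e , v∈e ← find positive
      with c , c≢u , c≢v ← third-colour (colour u) (colour v)
      = begin
          k                     ≡⟨ length-tabulate extension ⟨
          length (tabulate extension)
                                ≤⟨ unique-⊆⇒length≤ (tabulate⁺ extension-injective) is-edge ⟩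
          codegree tripartite u v ∎
      where
      open ≤-Reasoning
      extension : Fin k → Subset n
      extension i = triple u v (class c i)
      ≢class : ∀ {x} i → c ≢ colour x → colour x ≢ colour (class c i)
      ≢class i c≢x eq = c≢x (sym (trans eq (colour-class c i)))
      is-edge : ∀ {f} → f ∈ tabulate extension → f ∈ filter (pair? u v) (edges tripartite)
      is-edge f∈ with i , refl ← ∈-tabulate⁻ f∈ =
        ∈-filter⁺ (pair? u v)
          (rainbow⇒edge (rainbow-triple
            (proj₂ (edge⇒rainbow e∈) u v u∈e v∈e u≢v) (≢class i c≢u) (≢class i c≢v)))
          (∈-triple₁ u v _ , ∈-triple₂ u v _)
      -- The vertex `class c i` lies in the second triple, and its colour rules out u and v, so it
      -- must be `class c j`.
      extension-injective : ∀ {i j} → extension i ≡ extension j → i ≡ j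
      extension-injective {i} {j} eq
        with ∈-triple⁻ u v (class c j) (subst (class c i ∈ˢ_) eq (∈-triple₃ u v (class c i)))
      ... | inj₁ ≡u        = contradiction (cong colour (sym ≡u)) (≢class i c≢u)
      ... | inj₂ (inj₁ ≡v) = contradiction (cong colour (sym ≡v)) (≢class i c≢v)
      ... | inj₂ (inj₂ eq′) = class-injective c eq′

    -- An index i exists only when k is positive; the i-th vertices of the three classes then form a
    -- rainbow edge.
    tripartite-nonempty : Fin k → edges tripartite ≢ []
    tripartite-nonempty i edges≡[] = case subst (_ ∈_) edges≡[] (rainbow⇒edge
      (rainbow-triple (separate 0F 1F λ ()) (separate 0F 2F λ ()) (separate 1F 2F λ ()))) of λ ()
      where
      separate : ∀ c d → c ≢ d → colour (class c i) ≢ colour (class d i)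
      separate c d c≢d eq =
        c≢d (trans (sym (colour-class c i)) (trans eq (colour-class d i)))

-- Residues modulo 3 as a balanced colouring

residue : Fin n → Fin 3
residue v = toℕ v mod 3

residueClass<n : (c : Fin 3) (i : Fin (n / 3)) → toℕ c + toℕ i * 3 < n
residueClass<n {n} c i = begin-strict
  toℕ c + toℕ i * 3   <⟨ +-monoˡ-< (toℕ i * 3) (toℕ<n c) ⟩
  suc (toℕ i) * 3     ≤⟨ *-monoˡ-≤ 3 (toℕ<n i) ⟩
  n / 3 * 3           ≤⟨ m/n*n≤m n 3 ⟩
  n                   ∎
  where open ≤-Reasoning

-- The progression c, c + 3, c + 6, ..., cut off after `n / 3` terms: that many fit below n for
-- every residue c.
residueClass : Fin 3 → Fin (n / 3) → Fin n
residueClass c i = fromℕ< (residueClass<n c i)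

residueClass-injective : ∀ (c : Fin 3) {i j : Fin (n / 3)} →
  residueClass {n} c i ≡ residueClass c j → i ≡ j
residueClass-injective c {i} {j} eq = toℕ-injective (*-cancelʳ-≡ (toℕ i) (toℕ j) 3
  (+-cancelˡ-≡ (toℕ c) _ _
    (fromℕ<-injective _ _ (residueClass<n c i) (residueClass<n c j) eq)))

residue-residueClass : ∀ (c : Fin 3) (i : Fin (n / 3)) → residue (residueClass {n} c i) ≡ c
residue-residueClass {n} c i = toℕ-injective (begin
  toℕ (toℕ v mod 3)         ≡⟨ toℕ-fromℕ< (m%n<n (toℕ v) 3) ⟩
  toℕ v % 3                 ≡⟨ cong (_% 3) (toℕ-fromℕ< (residueClass<n {n} c i)) ⟩
  (toℕ c + toℕ i * 3) % 3   ≡⟨ [m+kn]%n≡m%n (toℕ c) (toℕ i) 3 ⟩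
  toℕ c % 3                 ≡⟨ m<n⇒m%n≡m (toℕ<n c) ⟩
  toℕ c                     ∎)
  where
  open ≡-Reasoning
  v = residueClass {n} c i

-- Existence of the extremal number

-- Either the empty list works, or one of the finitely many subsets is a head that some list within
-- the smaller length bound completes.
anyBoundedList? : ∀ m {P : List (Subset n) → Set} → Decidable P →
  Dec (∃ λ es → length es ≤ m × P es)
anyBoundedList? zero P? = map′
  (λ p → [] , z≤n , p)
  (λ { ([] , _ , p) → p })
  (P? [])
anyBoundedList? (suc m) P? = map′
  (λ { (inj₁ p) → [] , z≤n , p ; (inj₂ (e , es , ≤m , p)) → e ∷ es , s≤s ≤m , p })
  (λ { ([] , _ , p) → inj₁ p ; (e ∷ es , s≤s ≤m , p) → inj₂ (e , es , ≤m , p) })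
  (P? [] ⊎-dec anySubset? λ e → anyBoundedList? m (P? ∘ (e ∷_)))

-- An edge list has no repetitions, so it is no longer than the list of all subsets and the search
-- is finite. The search finds edge lists with its own proofs of uniqueness and uniformity; the
-- first hypothesis lets P pass between graphs that differ only in these proofs.
anyThreeGraph? : {P : ThreeGraph n → Set} →
  (∀ H H′ → edges H ≡ edges H′ → P H → P H′) → Decidable P → Dec (∃ P)
anyThreeGraph? {n} {P} resp P? = map′
  (λ (es , _ , u , un , p) → record { edges = es ; unique = u ; uniform = un } , p)
  (λ (H , p) → edges H , unique-⊆⇒length≤ (unique H) (λ _ → ∈-allSubsets _) ,
               unique H , uniform H , p)
  (anyBoundedList? (length (allSubsets n)) hasGraph?)
  where
  HasGraph : List (Subset n) → Set
  HasGraph es = Σ (Unique es) λ u → Σ (All (λ e → ∣ e ∣ ≡ 3) es) λ un →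
    P (record { edges = es ; unique = u ; uniform = un })
  hasGraph? : Decidable HasGraph
  hasGraph? es with DecUnique.unique? _≟ˢ_ es | All.all? (λ e → ∣ e ∣ ℕ.≟ 3) es
  ... | no ¬u | _      = no (¬u ∘ proj₁)
  ... | yes _ | no ¬un = no λ (_ , un , _) → ¬un un
  ... | yes u | yes un =
    map′ (λ p → u , un , p) (λ (_ , _ , p) → resp _ _ refl p)
         (P? (record { edges = es ; unique = u ; uniform = un }))

-- For a non-empty graph this asks for codegrees of at least k rather than for δ₂⁺ equal to k. The
-- greatest such k is the same, and deciding it involves no inner maximum.
Attains : ℕ → ThreeGraph n → Set
Attains k H = C₅⁻ -free H ×
  ((edges H ≡ [] × k ≡ 0) ⊎ (edges H ≢ [] × PositiveCodegreesAtLeast H k))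

attains? : ∀ k → Decidable (Attains {n} k)
attains? k H = C₅⁻-free? H ×-dec
  ((empty? (edges H) ×-dec (k ℕ.≟ 0)) ⊎-dec (¬? (empty? (edges H)) ×-dec codegrees?))
  where
  empty? : ∀ {A : Set} (xs : List A) → Dec (xs ≡ [])
  empty? []      = yes refl
  empty? (_ ∷ _) = no λ ()
  codegrees? : Dec (PositiveCodegreesAtLeast H k)
  codegrees? = all? λ u → all? λ v → ¬? (u ≟ v) →-dec
    (Any.any? (pair? u v) (edges H) →-dec (k ℕ.≤? codegree H u v))

-- `Attains` sees a graph only through its edge list, so once both records are opened and the lists
-- identified, the same proof serves.
attains-resp : ∀ k (H H′ : ThreeGraph n) → edges H ≡ edges H′ → Attains k H → Attains k H′
attains-resp k record {} record {} refl p = p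

attains-zero : ∃ (Attains {n} 0)
attains-zero =
  record { edges = [] ; unique = [] ; uniform = [] } ,
  (λ (_ , preserves) → case preserves 0F 1F 2F (here refl) of λ ()) ,
  inj₁ (refl , refl)

-- If `n / 3` is 0, the edgeless graph serves, as there are too few vertices for an edge. Otherwise
-- the residue colouring is used; the retained equation turns `0F` into the index that shows
-- non-emptiness.
attains-n/3 : ∃ (Attains {n} (n / 3))
attains-n/3 {n} = go (n / 3) refl
  where
  go : ∀ m → m ≡ n / 3 → ∃ (Attains {n} m)
  go zero    _  = attains-zero
  go (suc m) eq = subst (∃ ∘ Attains) (sym eq)
    ( tripartite residue
    , tripartite-free residue
    , inj₂ ( tripartite-nonempty residue residueClass (residueClass-injective {n})
               (residue-residueClass {n}) (subst Fin eq 0F)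
           , tripartite-codegrees residue residueClass (residueClass-injective {n})
               (residue-residueClass {n})))

-- If k + k exceeded n, any edge would lead to a copy, so a free graph would have no edges at all.
attains⇒k+k≤n : ∀ {k} → ∃ (Attains {n} k) → k + k ≤ n
attains⇒k+k≤n (_ , _ , inj₁ (_ , refl)) = z≤n
attains⇒k+k≤n {n} {k} (H , free , inj₂ (nonempty , δ≥k)) =
  decidable-stable (k + k ℕ.≤? n) λ k+k≰n →
    nonempty (no-member⇒≡[] λ e∈ →
      free (contains⇒copy H (edge⇒contains {H = H} δ≥k (≰⇒> k+k≰n) e∈)))
  where
  no-member⇒≡[] : {es : List (Subset n)} → (∀ {e} → e ∉ es) → es ≡ []
  no-member⇒≡[] {[]}    _    = refl
  no-member⇒≡[] {_ ∷ _} none = contradiction (here refl) none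

-- Descent from the bound: each value that fails P lowers it by one, and P 0 stops the descent.
bounded⇒maximum : {P : ℕ → Set} → Decidable P → P 0 → ∀ b → (∀ j → P j → j ≤ b) →
  ∃ (IsMaximum P)
bounded⇒maximum P? p₀ zero    bound = 0 , p₀ , bound
bounded⇒maximum P? p₀ (suc b) bound with P? (suc b)
... | yes p = suc b , p , bound
... | no ¬p = bounded⇒maximum P? p₀ b λ j pⱼ →
  ℕ.s≤s⁻¹ (≤∧≢⇒< (bound j pⱼ) λ { refl → ¬p pⱼ })

-- A non-empty graph attaining the greatest k has δ₂⁺ exactly k, because any j below all its
-- positive codegrees is attained by the same graph.
isMaximum-attains⇒isCo⁺ex : ∀ {k} → IsMaximum (λ k → ∃ (Attains {n} k)) k → IsCo⁺ex n C₅⁻ k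
isMaximum-attains⇒isCo⁺ex {n} {k} (attained , greatest) = realised attained , bounded
  where
  realised : ∃ (Attains {n} k) → ∃ λ (H : ThreeGraph n) → C₅⁻ -free H × IsMinPositiveCodegree H k
  realised (H , free , inj₁ empty) = H , free , inj₁ empty
  realised (H , free , inj₂ (nonempty , δ≥k)) =
    H , free , inj₂ (nonempty , δ≥k , λ j δ≥j → greatest j (H , free , inj₂ (nonempty , δ≥j)))
  bounded : ∀ j → (∃ λ (H : ThreeGraph n) → C₅⁻ -free H × IsMinPositiveCodegree H j) → j ≤ k
  bounded j (H , free , inj₁ empty) = greatest j (H , free , inj₁ empty)
  bounded j (H , free , inj₂ (nonempty , δ≥j , _)) = greatest j (H , free , inj₂ (nonempty , δ≥j))

-- The upper bound as a fraction, and the conclusion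

k+k≤n⇒k≤½n : ∀ k n → k + k ≤ n → ((+ k) /ℚ 1) ≤ℚ (½ *ℚ ((+ n) /ℚ 1))
-- Cross-multiplying k/1 ≤ (1 · n)/(2 · 1) gives k · 2 ≤ (1 · n) · 1.
k+k≤n⇒k≤½n k n k+k≤n = *≤* (begin
  + k ℤ.* + 2              ≡⟨ ℤ.pos-* k 2 ⟨
  + (k * 2)                ≡⟨ cong +_ (*-comm k 2) ⟩
  + (k + (k + 0))          ≡⟨ cong (λ m → + (k + m)) (+-identityʳ k) ⟩
  + (k + k)                ≤⟨ ℤ.+≤+ k+k≤n ⟩
  + n                      ≡⟨ ℤ.*-identityˡ (+ n) ⟨
  + 1 ℤ.* + n              ≡⟨ ℤ.*-identityʳ (+ 1 ℤ.* + n) ⟨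
  + 1 ℤ.* + n ℤ.* + 1      ∎)
  where open ℤ.≤-Reasoning

theorem15 : (n : ℕ) → .{{NonZero n}} →
    ∃ λ (k : ℕ) → IsCo⁺ex n C₅⁻ k × n / 3 ≤ k × ((+ k) /ℚ 1) ≤ℚ (½ *ℚ ((+ n) /ℚ 1))
theorem15 n =
  -- The descent may start at n, since j ≤ j + j ≤ n for every attained j.
  let k , attained , greatest = bounded⇒maximum
        (λ k → anyThreeGraph? (attains-resp k) (attains? k)) (attains-zero {n}) n
        (λ j attained → ≤-trans (m≤m+n j j) (attains⇒k+k≤n attained))
  in k , isMaximum-attains⇒isCo⁺ex (attained , greatest) , greatest (n / 3) (attains-n/3 {n}) ,
     k+k≤n⇒k≤½n k n (attains⇒k+k≤n attained)
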